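{- Let $G$ be a finite simple undirected $\delta$-regular graph of order $n\ge 1$ such that $\frac{n}{n-\delta}$ is an odd integer. Then $\kappa'(G)=\frac{n}{n-\delta}$ if and only if the complement graph $\overline G$ has a perfect code.
   Context: For a graph $G=(V,E)$ and $C\subseteq V$, let $Odd(C)=\{v\in V : |N(v)\cap C|\equiv 1 \pmod 2\}$, where $N(v)$ is the open neighborhood of $v$. A set $B\subseteq V$ is a weak odd dominated (WOD) set if there exists $C\subseteq V\setminus B$ with $B\subseteq Odd(C)$. $\kappa'(G)$ is the minimum size of a subset of $V$ that is not a WOD set. $\overline G$ is the complement graph of $G$. A perfect code of a graph with vertex set $V$ is a set $C\subseteq V$ such that $C$ is an independent set and every vertex in $V\setminus C$ has exactly one neighbor in $C$. -}

module Defs where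

open import Data.Fin.Base using (Fin; toℕ; fromℕ<; inject)
open import Data.Fin.Properties using (¬∀⟶∃¬-smallest; toℕ-fromℕ<; toℕ-inject; _≟_)
open import Data.Fin.Subset using (Subset; _∈_; _∉_; _⊆_; _∩_; ∁; ⊤; ∣_∣; Lift)
open import Data.Fin.Subset.Properties
  using (anySubset?; Lift?; _⊆?_; ∣p∣≤n; ∈⊤; ∣⊥∣≡0; x∈p⇒x∉∁p; Empty-unique; x∈p∩q⁻)
open import Data.Nat.Base using (ℕ; suc; _%_; _≤_; _<_; s≤s; NonZero; >-nonZero⁻¹)
open import Data.Nat.Properties using (≮⇒≥; 0≢1+n) renaming (_≟_ to _≟ℕ_)
open import Data.Product.Base using (∃; _×_; _,_; proj₁; proj₂)
open import Data.Vec.Base using (tabulate)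
open import Level using (0ℓ)
open import Relation.Binary.Core using (Rel)
open import Relation.Binary.Definitions using (Decidable; Irreflexive; Symmetric)
open import Relation.Binary.PropositionalEquality using (_≡_; _≢_; sym; trans; cong; ≢-sym)
open import Relation.Nullary using (¬_; does)
open import Relation.Nullary.Decidable using (_×-dec_; ¬?; decidable-stable)
open import Relation.Unary as U using (Pred)

IsOdd : ℕ → Set
IsOdd m = m % 2 ≡ 1

-- Finite simple undirected graphs of order n, with vertex set Fin n.
record Graph (n : ℕ) : Set₁ where
  infix 4 _~_ _~?_
  field
    _~_      : Rel (Fin n) 0ℓ
    _~?_     : Decidable _~_
    ~-sym    : Symmetric _~_
    ~-irrefl : Irreflexive _≡_ _~_

  N : Fin n → Subset n
  N v = tabulate (λ w → does (v ~? w))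

complement : ∀ {n} → Graph n → Graph n
complement G = record
  { _~_      = λ u v → u ≢ v × ¬ (u ~ v)
  ; _~?_     = λ u v → ¬? (u ≟ v) ×-dec ¬? (u ~? v)
  ; ~-sym    = λ (u≢v , u≁v) → ≢-sym u≢v , λ v~u → u≁v (~-sym v~u)
  ; ~-irrefl = λ u≡v (u≢v , _) → u≢v u≡v
  }
  where open Graph G

module _ {n : ℕ} (G : Graph n) where
  open Graph G

  Regular : ℕ → Set
  Regular δ = ∀ v → ∣ N v ∣ ≡ δ

  Odd : Subset n → Pred (Fin n) 0ℓ
  Odd C v = IsOdd ∣ N v ∩ C ∣

  -- Odd C is a predicate rather than a Subset: Lift (Odd C) B is B ⊆ Odd C.
  WOD : Pred (Subset n) 0ℓ
  WOD B = ∃ λ C → C ⊆ ∁ B × Lift (Odd C) B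

  Independent : Pred (Subset n) 0ℓ
  Independent C = ∀ {u v} → u ∈ C → v ∈ C → ¬ (u ~ v)

  PerfectCode : Pred (Subset n) 0ℓ
  PerfectCode C = Independent C × (∀ {v} → v ∉ C → ∣ N v ∩ C ∣ ≡ 1)

  HasPerfectCode : Set
  HasPerfectCode = ∃ PerfectCode

IsMinimumSize : ∀ {n} → Pred (Subset n) 0ℓ → ℕ → Set
IsMinimumSize P k = (∃ λ B → P B × ∣ B ∣ ≡ k) × (∀ B → P B → k ≤ ∣ B ∣)

minimumSize : ∀ {n} {P : Pred (Subset n) 0ℓ} → U.Decidable P → ∃ P →
              ∃ (IsMinimumSize P)
minimumSize {n} {P} P? (B₀ , pB₀) =
  let i , attained , below = smallest in
    toℕ i , decidable-stable (HasSize? (toℕ i)) attained , λ B pB → ≮⇒≥ λ ∣B∣<i →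
      below (fromℕ< ∣B∣<i)
        (B , pB , sym (trans (toℕ-inject (fromℕ< ∣B∣<i)) (toℕ-fromℕ< ∣B∣<i)))
  where
  HasSize : Pred ℕ 0ℓ
  HasSize k = ∃ λ B → P B × ∣ B ∣ ≡ k

  HasSize? : U.Decidable HasSize
  HasSize? k = anySubset? (λ B → P? B ×-dec (∣ B ∣ ≟ℕ k))

  bound : ∀ B → ∣ B ∣ < suc n
  bound B = s≤s (∣p∣≤n B)

  smallest : ∃ λ (i : Fin (suc n)) → ¬ ¬ HasSize (toℕ i) ×
             (∀ j → ¬ HasSize (toℕ (inject {i = i} j)))
  smallest = ¬∀⟶∃¬-smallest (suc n) (λ i → ¬ HasSize (toℕ i))
    (λ i → ¬? (HasSize? (toℕ i)))
    (λ none → none (fromℕ< (bound B₀)) (B₀ , pB₀ , sym (toℕ-fromℕ< (bound B₀))))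

module _ {n : ℕ} (G : Graph n) where
  open Graph G

  WOD? : U.Decidable (WOD G)
  WOD? B = anySubset? λ C → (C ⊆? ∁ B) ×-dec Lift? (λ v → (∣ N v ∩ C ∣ % 2) ≟ℕ 1) B

  ⊤-notWOD : .{{NonZero n}} → ¬ WOD G ⊤
  ⊤-notWOD (C , C⊆∁⊤ , odd) = 0≢1+n (trans (cong (_% 2) (sym ∣Nv∩C∣≡0)) (odd ∈⊤))
    where
    v : Fin n
    v = fromℕ< (>-nonZero⁻¹ n)

    ∣Nv∩C∣≡0 : ∣ N v ∩ C ∣ ≡ 0
    ∣Nv∩C∣≡0 = trans
      (cong ∣_∣ (Empty-unique λ (_ , x∈) → x∈p⇒x∉∁p ∈⊤ (C⊆∁⊤ (proj₂ (x∈p∩q⁻ (N v) C x∈)))))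
      (∣⊥∣≡0 n)

  -- With no vertices every set is WOD and the minimum does not exist, hence NonZero n.
  κ′-exists : .{{NonZero n}} → ∃ (IsMinimumSize (λ B → ¬ WOD G B))
  κ′-exists = minimumSize (λ B → ¬? (WOD? B)) (⊤ , ⊤-notWOD)

  κ′ : .{{NonZero n}} → ℕ
  κ′ = proj₁ κ′-exists

{-# OPTIONS --safe #-}
-- In the complement H of G every closed neighbourhood has n ∸ δ elements, so the closed
-- neighbourhoods of B cover the vertices ∣ B ∣ * (n ∸ δ) times in total. A set B that is not
-- WOD dominates H, since otherwise {v} odd-dominates B for an undominated v; hence
-- n ≤ ∣ B ∣ * (n ∸ δ), with equality only if B is a perfect code of H. Conversely, if a perfect
-- code C of H of odd size were odd-dominated in G by C′, the number of edges of G between C and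
-- C′ would be odd counted from C, but even counted from C′, where each vertex has ∣ C ∣ ∸ 1
-- neighbours in C.
module Submission where

open import Defs
open import Data.Bool.Base using (true; false; if_then_else_; _∧_)
open import Data.Fin.Base using (Fin; zero; suc)
open import Data.Fin.Properties using (_≟_)
open import Data.Fin.Subset
  using (Subset; inside; outside; _∈_; _∉_; _∩_; _⊆_; ∁; ⊤; ⁅_⁆; ∣_∣; Empty)
open import Data.Fin.Subset.Properties
open import Data.Nat.Base
  using (ℕ; zero; suc; _+_; _*_; _∸_; _%_; _≤_; z≤n; NonZero; ≢-nonZero; ≢-nonZero⁻¹)
open import Data.Nat.Divisibility using (_∣_; quotient; divides)
open import Data.Nat.DivMod using (%-distribˡ-+)
open import Data.Nat.Properties hiding (_≟_)
open import Algebra.Properties.Semiring.Sum +-*-semiring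
  using (sum; sum-syntax; sum-cong-≗; sum-replicate-zero; ∑-comm; ∑-distrib-+;
         *-distribˡ-sum; *-distribʳ-sum)
open import Data.Product.Base using (_,_; proj₁; proj₂)
open import Data.Vec.Base using ([]; _∷_; lookup)
open import Data.Vec.Properties
  using (lookup∘tabulate; lookup-zipWith; []=⇒lookup; lookup⇒[]=)
open import Function.Base using (_∘_; const)
open import Function.Bundles using (_⇔_; mk⇔)
open import Relation.Binary.PropositionalEquality
open import Relation.Nullary using (¬_; yes; no; does; contradiction)
open import Relation.Nullary.Decidable using (dec-true; dec-false; decidable-stable)

private
  variable
    n : ℕ

-- Sums of natural numbers over `Fin n`, and parity.

sum-mono-≤ : {f g : Fin n → ℕ} → (∀ i → f i ≤ g i) → sum f ≤ sum g
sum-mono-≤ {zero}  f≤g = z≤n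
sum-mono-≤ {suc n} f≤g = +-mono-≤ (f≤g zero) (sum-mono-≤ (f≤g ∘ suc))

-- A deficit of `f` in one term would have to be made up by an excess in another, which `f≤g` rules
-- out.
≤∧sum≡⇒≗ : {f g : Fin n → ℕ} → (∀ i → f i ≤ g i) → sum f ≡ sum g → f ≗ g
≤∧sum≡⇒≗ {suc n} {f} {g} f≤g eq = λ where
    zero    → head≡
    (suc i) → ≤∧sum≡⇒≗ (f≤g ∘ suc) tail≡ i
  where
  head≡ : f zero ≡ g zero
  head≡ = ≤-antisym (f≤g zero) (+-cancelʳ-≤ (sum (g ∘ suc)) _ _
    (≤-trans (≤-reflexive (sym eq)) (+-monoʳ-≤ (f zero) (sum-mono-≤ (f≤g ∘ suc)))))

  tail≡ : sum (f ∘ suc) ≡ sum (g ∘ suc)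
  tail≡ = +-cancelˡ-≡ (g zero) _ _ (trans (cong (_+ sum (f ∘ suc)) (sym head≡)) eq)

sum-const : ∀ n k → sum {n} (const k) ≡ n * k
sum-const zero    k = refl
sum-const (suc n) k = cong (k +_) (sum-const n k)

sum-%-cong : ∀ {f g : Fin n → ℕ} d .{{_ : NonZero d}} →
             (∀ i → f i % d ≡ g i % d) → sum f % d ≡ sum g % d
sum-%-cong {zero}          d f≡g = refl
sum-%-cong {suc n} {f} {g} d f≡g = begin
  (f zero + sum (f ∘ suc)) % d          ≡⟨ %-distribˡ-+ (f zero) _ d ⟩
  (f zero % d + sum (f ∘ suc) % d) % d
    ≡⟨ cong₂ (λ a b → (a + b) % d) (f≡g zero) (sum-%-cong d (f≡g ∘ suc)) ⟩
  (g zero % d + sum (g ∘ suc) % d) % d  ≡⟨ %-distribˡ-+ (g zero) _ d ⟨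
  (g zero + sum (g ∘ suc)) % d          ∎
  where open ≡-Reasoning

suc-odd⇒even : ∀ k → IsOdd (suc k) → k % 2 ≡ 0
suc-odd⇒even zero          _   = refl
-- Remainders modulo 2 are unchanged by two successors definitionally; the clause for `suc zero` is
-- absent because its hypothesis reduces to `0 ≡ 1`.
suc-odd⇒even (suc (suc k)) odd = suc-odd⇒even k odd

-- Natural-valued indicators, which turn cardinalities into sums.

χ : Subset n → Fin n → ℕ
χ p v = if lookup p v then 1 else 0

χ-∈ : ∀ {p : Subset n} {v} → v ∈ p → χ p v ≡ 1
χ-∈ v∈p = cong (if_then 1 else 0) ([]=⇒lookup v∈p)

χ-∉ : ∀ {p : Subset n} {v} → v ∉ p → χ p v ≡ 0
χ-∉ {p = p} {v} v∉p with lookup p v in eq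
... | true  = contradiction (lookup⇒[]= v p eq) v∉p
... | false = refl

χ-∩ : ∀ (p q : Subset n) v → χ (p ∩ q) v ≡ χ p v * χ q v
χ-∩ p q v = trans (cong (if_then 1 else 0) (lookup-zipWith _∧_ v p q)) (χ-∧ (lookup p v) (lookup q v))
  where
  χ-∧ : ∀ a b → (if a ∧ b then 1 else 0) ≡
              (if a then 1 else 0) * (if b then 1 else 0)
  χ-∧ true  b = sym (*-identityˡ _)
  χ-∧ false b = refl

∣p∣≡∑χ : ∀ (p : Subset n) → ∣ p ∣ ≡ sum (χ p)
∣p∣≡∑χ []            = refl
∣p∣≡∑χ (inside  ∷ p) = cong suc (∣p∣≡∑χ p)
∣p∣≡∑χ (outside ∷ p) = ∣p∣≡∑χ p

∣p∩q∣≡∑χ*χ : ∀ (p q : Subset n) → ∣ p ∩ q ∣ ≡ ∑[ v < n ] (χ p v * χ q v)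
∣p∩q∣≡∑χ*χ p q = trans (∣p∣≡∑χ (p ∩ q)) (sum-cong-≗ (χ-∩ p q))

∣⁅v⁆∩p∣≡χ : ∀ v (p : Subset n) → ∣ ⁅ v ⁆ ∩ p ∣ ≡ χ p v
∣⁅v⁆∩p∣≡χ {suc n} zero (inside  ∷ p) = cong suc (trans (cong ∣_∣ (∩-zeroˡ p)) (∣⊥∣≡0 n))
∣⁅v⁆∩p∣≡χ {suc n} zero (outside ∷ p) = trans (cong ∣_∣ (∩-zeroˡ p)) (∣⊥∣≡0 n)
∣⁅v⁆∩p∣≡χ (suc v) (s ∷ p) = ∣⁅v⁆∩p∣≡χ v p

Empty⇒∣p∣≡0 : {p : Subset n} → Empty p → ∣ p ∣ ≡ 0
Empty⇒∣p∣≡0 {n} ∄ = trans (cong ∣_∣ (Empty-unique ∄)) (∣⊥∣≡0 n)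

∣p∣≡0⇒∉ : ∀ {p : Subset n} {v} → ∣ p ∣ ≡ 0 → v ∉ p
∣p∣≡0⇒∉ ∣p∣≡0 v∈p = contradiction ∣p∣≡0 (m<n⇒n≢0 (x∈p⇒∣p-x∣<∣p∣ v∈p))

-- Counting adjacencies within one graph.

module _ (G : Graph n) where
  open Graph G

  ∈N⁺ : ∀ {v w} → v ~ w → w ∈ N v
  ∈N⁺ {v} {w} v~w = lookup⇒[]= w (N v)
    (trans (lookup∘tabulate (λ w → does (v ~? w)) w) (dec-true (v ~? w) v~w))

  ∈N⁻ : ∀ {v w} → w ∈ N v → v ~ w
  ∈N⁻ {v} {w} w∈Nv = decidable-stable (v ~? w) λ v≁w → contradiction
    (trans (sym ([]=⇒lookup w∈Nv))
      (trans (lookup∘tabulate (λ w → does (v ~? w)) w) (dec-false (v ~? w) v≁w)))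
    λ()

  χ-N-sym : ∀ v w → χ (N v) w ≡ χ (N w) v
  χ-N-sym v w with v ~? w
  ... | yes v~w = trans (χ-∈ (∈N⁺ v~w)) (sym (χ-∈ (∈N⁺ (~-sym v~w))))
  ... | no  v≁w = trans (χ-∉ (v≁w ∘ ∈N⁻)) (sym (χ-∉ (v≁w ∘ ~-sym ∘ ∈N⁻)))

  -- Both sides count the adjacent pairs with one end in `A` and the other in `B`: exchange the sums
  -- and use the symmetry of adjacency.
  double-counting : ∀ A B →
    ∑[ v < n ] (χ A v * ∣ N v ∩ B ∣) ≡ ∑[ w < n ] (χ B w * ∣ N w ∩ A ∣)
  double-counting A B = begin
    ∑[ v < n ] (χ A v * ∣ N v ∩ B ∣)                      ≡⟨ sum-cong-≗ (expand A B) ⟩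
    ∑[ v < n ] ∑[ w < n ] (χ A v * (χ (N v) w * χ B w))   ≡⟨ ∑-comm (λ v w → χ A v * (χ (N v) w * χ B w)) ⟩
    ∑[ w < n ] ∑[ v < n ] (χ A v * (χ (N v) w * χ B w))
      ≡⟨ sum-cong-≗ (λ w → sum-cong-≗ (swap w)) ⟩
    ∑[ w < n ] ∑[ v < n ] (χ B w * (χ (N w) v * χ A v))   ≡⟨ sum-cong-≗ (expand B A) ⟨
    ∑[ w < n ] (χ B w * ∣ N w ∩ A ∣)                      ∎
    where
    open ≡-Reasoning
    expand : ∀ A B v → χ A v * ∣ N v ∩ B ∣ ≡ ∑[ w < n ] (χ A v * (χ (N v) w * χ B w))
    expand A B v = trans (cong (χ A v *_) (∣p∩q∣≡∑χ*χ (N v) B)) (*-distribˡ-sum (χ A v) (λ w → χ (N v) w * χ B w))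

    swap : ∀ w v → χ A v * (χ (N v) w * χ B w) ≡ χ B w * (χ (N w) v * χ A v)
    swap w v = begin
      χ A v * (χ (N v) w * χ B w)  ≡⟨ cong (λ x → χ A v * (x * χ B w)) (χ-N-sym v w) ⟩
      χ A v * (χ (N w) v * χ B w)  ≡⟨ *-assoc (χ A v) (χ (N w) v) (χ B w) ⟨
      χ A v * χ (N w) v * χ B w    ≡⟨ *-comm _ (χ B w) ⟩
      χ B w * (χ A v * χ (N w) v)  ≡⟨ cong (χ B w *_) (*-comm (χ A v) _) ⟩
      χ B w * (χ (N w) v * χ A v)  ∎

  -- Double counting against `⊤`: each vertex of `C` is counted once from each of its `δ`
  -- neighbours.
  ∑-degree-into : ∀ {δ} → Regular G δ → ∀ C → ∑[ v < n ] ∣ N v ∩ C ∣ ≡ ∣ C ∣ * δ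
  ∑-degree-into {δ} reg C = begin
    ∑[ v < n ] ∣ N v ∩ C ∣
      ≡⟨ sum-cong-≗ (λ v → trans (cong (_* ∣ N v ∩ C ∣) (χ-∈ (∈⊤ {x = v}))) (*-identityˡ _)) ⟨
    ∑[ v < n ] (χ ⊤ v * ∣ N v ∩ C ∣)  ≡⟨ double-counting ⊤ C ⟩
    ∑[ w < n ] (χ C w * ∣ N w ∩ ⊤ ∣)
      ≡⟨ sum-cong-≗ (λ w → cong (χ C w *_) (trans (cong ∣_∣ (∩-identityʳ (N w))) (reg w))) ⟩
    ∑[ w < n ] (χ C w * δ)            ≡⟨ *-distribʳ-sum δ (χ C) ⟨
    sum (χ C) * δ                     ≡⟨ cong (_* δ) (∣p∣≡∑χ C) ⟨
    ∣ C ∣ * δ                         ∎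
    where open ≡-Reasoning

  -- The number of elements of C whose closed neighbourhood contains v.
  cover : Subset n → Fin n → ℕ
  cover C v = χ C v + ∣ N v ∩ C ∣

  -- The two ways of writing 1 as the sum defining `cover` are the two clauses of a perfect code: 1
  -- + 0 inside `C` gives independence, 0 + 1 outside gives the unique neighbour.
  cover≡1⇒perfect : ∀ {C} → cover C ≗ const 1 → PerfectCode G C
  cover≡1⇒perfect {C} cover≡1 =
    (λ {u} {v} u∈C v∈C u~v → ∣p∣≡0⇒∉
      (suc-injective (trans (cong (_+ ∣ N u ∩ C ∣) (sym (χ-∈ u∈C))) (cover≡1 u)))
      (x∈p∩q⁺ (∈N⁺ u~v , v∈C))) ,
    (λ {v} v∉C → trans (cong (_+ ∣ N v ∩ C ∣) (sym (χ-∉ v∉C))) (cover≡1 v))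

  perfect⇒cover≡1 : ∀ {C} → PerfectCode G C → cover C ≗ const 1
  perfect⇒cover≡1 {C} (indep , unique) v with v ∈? C
  ... | yes v∈C = cong₂ _+_ (χ-∈ v∈C) (Empty⇒∣p∣≡0 λ (w , w∈) →
    let w∈Nv , w∈C = x∈p∩q⁻ (N v) C w∈ in indep v∈C w∈C (∈N⁻ w∈Nv))
  ... | no  v∉C = cong₂ _+_ (χ-∉ v∉C) (unique v∉C)

-- A graph and the closed neighbourhoods of its complement.

module _ (G : Graph n) where
  open Graph G
  private
    H : Graph n
    H = complement G
    module H = Graph H

  χ-partition : ∀ v w → χ (N v) w + (χ ⁅ v ⁆ w + χ (H.N v) w) ≡ 1
  χ-partition v w with v ≟ w | v ~? w
  ... | yes refl | _ = cong₂ _+_ (χ-∉ (~-irrefl refl ∘ ∈N⁻ G))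
    (cong₂ _+_ (χ-∈ (x∈⁅x⁆ v)) (χ-∉ (H.~-irrefl refl ∘ ∈N⁻ H)))
  ... | no v≢w | yes v~w = cong₂ _+_ (χ-∈ (∈N⁺ G v~w))
    (cong₂ _+_ (χ-∉ (x≢y⇒x∉⁅y⁆ (≢-sym v≢w))) (χ-∉ λ w∈ → proj₂ (∈N⁻ H w∈) v~w))
  ... | no v≢w | no v≁w = cong₂ _+_ (χ-∉ (v≁w ∘ ∈N⁻ G))
    (cong₂ _+_ (χ-∉ (x≢y⇒x∉⁅y⁆ (≢-sym v≢w))) (χ-∈ (∈N⁺ H (v≢w , v≁w))))

  -- This is `χ-partition` weighted by `χ C` and summed over `w`. It translates covering in `H` into
  -- degrees in `G`.
  degree+cover : ∀ C v → ∣ N v ∩ C ∣ + cover H C v ≡ ∣ C ∣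
  degree+cover C v = begin
    ∣ N v ∩ C ∣ + (χ C v + ∣ H.N v ∩ C ∣)
      ≡⟨ cong₂ _+_ (∣p∩q∣≡∑χ*χ (N v) C)
           (cong₂ _+_ (trans (sym (∣⁅v⁆∩p∣≡χ v C)) (∣p∩q∣≡∑χ*χ ⁅ v ⁆ C)) (∣p∩q∣≡∑χ*χ (H.N v) C)) ⟩
    sum (λ w → χ (N v) w * χ C w) + (sum (λ w → χ ⁅ v ⁆ w * χ C w) + sum (λ w → χ (H.N v) w * χ C w))
      ≡⟨ cong (sum (λ w → χ (N v) w * χ C w) +_) (∑-distrib-+ (λ w → χ ⁅ v ⁆ w * χ C w) _) ⟨
    sum (λ w → χ (N v) w * χ C w) + sum (λ w → χ ⁅ v ⁆ w * χ C w + χ (H.N v) w * χ C w)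
      ≡⟨ ∑-distrib-+ (λ w → χ (N v) w * χ C w) _ ⟨
    sum (λ w → χ (N v) w * χ C w + (χ ⁅ v ⁆ w * χ C w + χ (H.N v) w * χ C w))
      ≡⟨ sum-cong-≗ collect ⟩
    sum (χ C)
      ≡⟨ ∣p∣≡∑χ C ⟨
    ∣ C ∣ ∎
    where
    open ≡-Reasoning
    collect : ∀ w → χ (N v) w * χ C w + (χ ⁅ v ⁆ w * χ C w + χ (H.N v) w * χ C w) ≡ χ C w
    collect w = begin
      χ (N v) w * χ C w + (χ ⁅ v ⁆ w * χ C w + χ (H.N v) w * χ C w)
        ≡⟨ cong (χ (N v) w * χ C w +_) (*-distribʳ-+ (χ C w) (χ ⁅ v ⁆ w) _) ⟨
      χ (N v) w * χ C w + (χ ⁅ v ⁆ w + χ (H.N v) w) * χ C w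
        ≡⟨ *-distribʳ-+ (χ C w) (χ (N v) w) _ ⟨
      (χ (N v) w + (χ ⁅ v ⁆ w + χ (H.N v) w)) * χ C w
        ≡⟨ cong (_* χ C w) (χ-partition v w) ⟩
      1 * χ C w
        ≡⟨ *-identityˡ (χ C w) ⟩
      χ C w ∎

  -- Summing `degree+cover` over all vertices gives `∣ C ∣ * n`, and by regularity the degrees in
  -- `G` account for `∣ C ∣ * δ` of it.
  ∑-cover : ∀ {δ} → Regular G δ → ∀ C → sum (cover H C) ≡ ∣ C ∣ * (n ∸ δ)
  ∑-cover {δ} reg C = begin
    sum (cover H C)                          ≡⟨ m+n∸m≡n (∣ C ∣ * δ) _ ⟨
    ∣ C ∣ * δ + sum (cover H C) ∸ ∣ C ∣ * δ  ≡⟨ cong (_∸ ∣ C ∣ * δ) total ⟩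
    ∣ C ∣ * n ∸ ∣ C ∣ * δ                    ≡⟨ *-distribˡ-∸ ∣ C ∣ n δ ⟨
    ∣ C ∣ * (n ∸ δ)                          ∎
    where
    open ≡-Reasoning
    total : ∣ C ∣ * δ + sum (cover H C) ≡ ∣ C ∣ * n
    total = begin
      ∣ C ∣ * δ + sum (cover H C)                    ≡⟨ cong (_+ sum (cover H C)) (∑-degree-into G reg C) ⟨
      ∑[ v < n ] ∣ N v ∩ C ∣ + sum (cover H C)       ≡⟨ ∑-distrib-+ (λ v → ∣ N v ∩ C ∣) _ ⟨
      ∑[ v < n ] (∣ N v ∩ C ∣ + cover H C v)         ≡⟨ sum-cong-≗ (degree+cover C) ⟩
      ∑[ v < n ] ∣ C ∣                               ≡⟨ sum-const n ∣ C ∣ ⟩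
      n * ∣ C ∣                                      ≡⟨ *-comm n ∣ C ∣ ⟩
      ∣ C ∣ * n                                      ∎

  -- WOD sets of the graph versus domination in the complement.

  uncovered⇒WOD : ∀ {B v} → cover H B v ≡ 0 → WOD G B
  uncovered⇒WOD {B} {v} cover≡0 = ⁅ v ⁆ , ⁅v⁆⊆∁B , odd
    where
    v∉B : v ∉ B
    v∉B v∈B = contradiction (trans (sym (χ-∈ v∈B)) (m+n≡0⇒m≡0 (χ B v) cover≡0)) λ()

    ⁅v⁆⊆∁B : ⁅ v ⁆ ⊆ ∁ B
    ⁅v⁆⊆∁B w∈ = subst (_∈ ∁ B) (sym (x∈⁅y⁆⇒x≡y v w∈)) (x∉p⇒x∈∁p v∉B)

    -- A vertex that is neither in `B` nor adjacent in `H` to any member of `B` is adjacent in `G`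
    -- to all of `B`, so `⁅ v ⁆` meets each `N b` in exactly one vertex.
    adjacent : ∀ {b} → b ∈ B → v ~ b
    adjacent {b} b∈B = decidable-stable (v ~? b) λ v≁b →
      ∣p∣≡0⇒∉ (m+n≡0⇒n≡0 (χ B v) cover≡0)
        (x∈p∩q⁺ (∈N⁺ H ((λ { refl → v∉B b∈B }) , v≁b) , b∈B))

    odd : ∀ {b} → b ∈ B → Odd G ⁅ v ⁆ b
    odd {b} b∈B = cong (_% 2) (begin
      ∣ N b ∩ ⁅ v ⁆ ∣  ≡⟨ cong ∣_∣ (∩-comm (N b) ⁅ v ⁆) ⟩
      ∣ ⁅ v ⁆ ∩ N b ∣  ≡⟨ ∣⁅v⁆∩p∣≡χ v (N b) ⟩
      χ (N b) v        ≡⟨ χ-∈ (∈N⁺ G (~-sym (adjacent b∈B))) ⟩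
      1                ∎)
      where open ≡-Reasoning

  ¬WOD⇒1≤cover : ∀ {B} → ¬ WOD G B → ∀ v → 1 ≤ cover H B v
  ¬WOD⇒1≤cover ¬wod v = n≢0⇒n>0 (¬wod ∘ uncovered⇒WOD)

  -- The closed neighbourhoods of a perfect code partition the vertex set. This fixes the size of
  -- the code.
  ∣perfect∣ : ∀ {δ C} → Regular G δ → PerfectCode H C → n ≡ ∣ C ∣ * (n ∸ δ)
  ∣perfect∣ {δ} {C} reg perfect = begin
    n                     ≡⟨ *-identityʳ n ⟨
    n * 1                 ≡⟨ sum-const n 1 ⟨
    sum {n} (const 1)     ≡⟨ sum-cong-≗ (perfect⇒cover≡1 H perfect) ⟨
    sum (cover H C)       ≡⟨ ∑-cover reg C ⟩
    ∣ C ∣ * (n ∸ δ)       ∎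
    where open ≡-Reasoning

  ¬WOD⇒n≤ : ∀ {δ B} → Regular G δ → ¬ WOD G B → n ≤ ∣ B ∣ * (n ∸ δ)
  ¬WOD⇒n≤ {δ} {B} reg ¬wod = begin
    n                  ≡⟨ *-identityʳ n ⟨
    n * 1              ≡⟨ sum-const n 1 ⟨
    sum {n} (const 1)  ≤⟨ sum-mono-≤ (¬WOD⇒1≤cover ¬wod) ⟩
    sum (cover H B)    ≡⟨ ∑-cover reg B ⟩
    ∣ B ∣ * (n ∸ δ)    ∎
    where open ≤-Reasoning

  -- The cover values are all at least 1 and sum to `n`, so each of them is exactly 1.
  ¬WOD∧tight⇒perfect : ∀ {δ B} → Regular G δ → ¬ WOD G B → n ≡ ∣ B ∣ * (n ∸ δ) →
                       PerfectCode H B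
  ¬WOD∧tight⇒perfect {B = B} reg ¬wod n≡ = cover≡1⇒perfect H (sym ∘ ≤∧sum≡⇒≗ (¬WOD⇒1≤cover ¬wod)
    (trans (sum-const n 1) (trans (*-identityʳ n) (trans n≡ (sym (∑-cover reg B))))))

  odd-perfect⇒¬WOD : ∀ {C} → PerfectCode H C → IsOdd ∣ C ∣ → ¬ WOD G C
  odd-perfect⇒¬WOD {C} perfect odd (C′ , C′⊆∁C , dominated) = contradiction
    (begin
      1                                               ≡⟨ odd ⟨
      ∣ C ∣ % 2                                       ≡⟨ cong (_% 2) (∣p∣≡∑χ C) ⟩
      -- Each vertex of `C` has odd degree into `C′`, so the number of edges between them has the
      -- parity of `∣ C ∣`.
      sum (χ C) % 2                                   ≡⟨ sum-%-cong 2 from-C ⟨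
      (∑[ v < n ] (χ C v * ∣ N v ∩ C′ ∣)) % 2         ≡⟨ cong (_% 2) (double-counting G C C′) ⟩
      (∑[ w < n ] (χ C′ w * ∣ N w ∩ C ∣)) % 2         ≡⟨ sum-%-cong 2 from-C′ ⟩
      sum {n} (const 0) % 2                           ≡⟨ cong (_% 2) (sum-replicate-zero n) ⟩
      0                                               ∎)
    λ()
    where
    open ≡-Reasoning
    from-C : ∀ v → (χ C v * ∣ N v ∩ C′ ∣) % 2 ≡ χ C v % 2
    from-C v with v ∈? C
    ... | yes v∈C = begin
      (χ C v * ∣ N v ∩ C′ ∣) % 2  ≡⟨ cong (λ x → (x * ∣ N v ∩ C′ ∣) % 2) (χ-∈ v∈C) ⟩
      (1 * ∣ N v ∩ C′ ∣) % 2      ≡⟨ cong (_% 2) (*-identityˡ ∣ N v ∩ C′ ∣) ⟩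
      ∣ N v ∩ C′ ∣ % 2            ≡⟨ dominated v∈C ⟩
      1                           ≡⟨ cong (_% 2) (χ-∈ v∈C) ⟨
      χ C v % 2                   ∎
    ... | no v∉C = begin
      (χ C v * ∣ N v ∩ C′ ∣) % 2  ≡⟨ cong (λ x → (x * ∣ N v ∩ C′ ∣) % 2) (χ-∉ v∉C) ⟩
      0                           ≡⟨ cong (_% 2) (χ-∉ v∉C) ⟨
      χ C v % 2                   ∎

    even-degree : ∀ w → ∣ N w ∩ C ∣ % 2 ≡ 0
    -- Exactly one member of `C` is `w` or a neighbour of `w` in `H`; the others, an even number,
    -- are the neighbours of `w` in `G`.
    even-degree w = suc-odd⇒even ∣ N w ∩ C ∣ (trans (cong (_% 2) (begin
      suc ∣ N w ∩ C ∣              ≡⟨ +-comm 1 _ ⟩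
      ∣ N w ∩ C ∣ + 1              ≡⟨ cong (∣ N w ∩ C ∣ +_) (perfect⇒cover≡1 H perfect w) ⟨
      ∣ N w ∩ C ∣ + cover H C w    ≡⟨ degree+cover C w ⟩
      ∣ C ∣                        ∎)) odd)

    from-C′ : ∀ w → (χ C′ w * ∣ N w ∩ C ∣) % 2 ≡ 0
    from-C′ w with w ∈? C′
    ... | yes w∈C′ = trans (cong (λ x → (x * ∣ N w ∩ C ∣) % 2) (χ-∈ w∈C′))
      (trans (cong (_% 2) (*-identityˡ ∣ N w ∩ C ∣)) (even-degree w))
    ... | no w∉C′ = cong (λ x → (x * ∣ N w ∩ C ∣) % 2) (χ-∉ w∉C′)

theorem4 : ∀ (n δ : ℕ) .{{_ : NonZero n}} (G : Graph n) → Regular G δ →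
    (d : (n ∸ δ) ∣ n) → IsOdd (quotient d) →
    (κ′ G ≡ quotient d) ⇔ HasPerfectCode (complement G)
theorem4 n δ G reg (divides q n≡q*k) odd = mk⇔ to from
  where
  instance
    -- If `n ∸ δ` were zero, its multiple `n` would be too; this permits the cancellations below.
    k≢0 : NonZero (n ∸ δ)
    k≢0 = ≢-nonZero λ k≡0 →
      ≢-nonZero⁻¹ n (trans n≡q*k (trans (cong (q *_) k≡0) (*-zeroʳ q)))

  to : κ′ G ≡ q → HasPerfectCode (complement G)
  to κ′≡q with proj₁ (proj₂ (κ′-exists G))
  -- A minimum non-WOD set has size `q`, so it attains equality in the counting bound and is itself
  -- the perfect code.
  ... | B , ¬wod , ∣B∣≡κ′ = B , ¬WOD∧tight⇒perfect G reg ¬wod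
    (trans n≡q*k (cong (_* (n ∸ δ)) (sym (trans ∣B∣≡κ′ κ′≡q))))

  from : HasPerfectCode (complement G) → κ′ G ≡ q
  from (C , perfect) = ≤-antisym κ′≤q q≤κ′
    where
    ∣C∣≡q : ∣ C ∣ ≡ q
    ∣C∣≡q = *-cancelʳ-≡ _ _ (n ∸ δ) (trans (sym (∣perfect∣ G reg perfect)) n≡q*k)

    κ′≤q : κ′ G ≤ q
    -- The code has odd size `q`, hence is one of the non-WOD sets over which the minimum is taken.
    κ′≤q = subst (κ′ G ≤_) ∣C∣≡q (proj₂ (proj₂ (κ′-exists G)) C
      (odd-perfect⇒¬WOD G perfect (subst IsOdd (sym ∣C∣≡q) odd)))

    q≤κ′ : q ≤ κ′ G
    q≤κ′ with proj₁ (proj₂ (κ′-exists G))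
    ... | B , ¬wod , ∣B∣≡κ′ = subst (q ≤_) ∣B∣≡κ′
      -- The bound `n ≤ ∣ B ∣ * (n ∸ δ)` reads `q * (n ∸ δ) ≤ ∣ B ∣ * (n ∸ δ)`.
      (*-cancelʳ-≤ _ _ (n ∸ δ) (≤-trans (≤-reflexive (sym n≡q*k)) (¬WOD⇒n≤ G reg ¬wod)))
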